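{- $\mathfrak{icp}(\mathsf{null}\setminus\{\emptyset\},\subseteq)=\operatorname{add}(\mathsf{null})$.
   Context: $\mathsf{null}$ is the ideal of Lebesgue measure zero subsets of $2^\omega$, here ordered by inclusion. For a poset $(P,\le)$, $F\subseteq P$ is an incomparable family if for every $p\in P$ there is $q\in F$ with $p\not\le q$ and $q\not\le p$; $\mathfrak{icp}(P)$ is the minimal size of an incomparable family. $\operatorname{add}(\mathsf{null})$ is the minimal size of a family of null sets whose union is not null. -}

module Defs where

open import Data.Bool.Base using (Bool)
open import Data.Fin.Base using (toℕ)
open import Data.List.Base using (List; []; _∷_; length; lookup)
open import Data.Nat.Base using (ℕ; zero; suc)
open import Data.Product.Base using (∃-syntax; Σ-syntax; _×_; proj₁)
open import Data.Rational.Base using (ℚ; 0ℚ; 1ℚ; ½; _+_; _*_; _≤_; _<_)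
open import Function.Bundles using (Injection; Bijection)
open import Level using (Level; 0ℓ; _⊔_) renaming (suc to lsuc)
open import Relation.Binary.Bundles using (Setoid; Poset)
open import Relation.Binary.PropositionalEquality.Core using (_≡_)
import Relation.Binary.Construct.On as On
open import Relation.Nullary.Negation.Core using (¬_)
open import Relation.Unary using (Pred; _∈_; _⊆_; _≐_; ∅)
open import Relation.Unary.Relation.Binary.Subset using (⊆-poset)

private
  variable
    a c ℓ ℓ₁ ℓ₂ p : Level

-- Subsets are predicates valued in Set at level 0, whatever the level of A.
-- Given excluded middle this loses nothing: every predicate on A is then
-- equivalent to one of these.

Subset : Set a → Set (a ⊔ lsuc 0ℓ)
Subset A = Pred A 0ℓ

------------------------------------------------------------------------
-- Null sets in 2^ω

Cantor : Set
Cantor = ℕ → Bool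

Cylinder : List Bool → Subset Cantor
Cylinder s x = ∀ i → x (toℕ i) ≡ lookup s i

-- The measure 2^(- length s) of Cylinder s.

μ : List Bool → ℚ
μ []      = 1ℚ
μ (_ ∷ s) = ½ * μ s

partialSum : (ℕ → ℚ) → ℕ → ℚ
partialSum f zero    = 0ℚ
partialSum f (suc n) = partialSum f n + f n

-- Lebesgue (outer) measure zero. The terms of the series Σₙ μ (s n) are
-- positive, so its sum is at most ε exactly when all partial sums are.

Null : Pred Cantor ℓ → Set ℓ
Null A = ∀ ε → 0ℚ < ε →
  Σ[ s ∈ (ℕ → List Bool) ] (A ⊆ λ x → ∃[ n ] x ∈ Cylinder (s n))
                         × (∀ n → partialSum (λ i → μ (s i)) n ≤ ε)

null : Poset (lsuc 0ℓ) 0ℓ 0ℓ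
null = On.poset (⊆-poset Cantor 0ℓ) (proj₁ {B = Null})

null∖∅ : Poset (lsuc 0ℓ) 0ℓ 0ℓ
null∖∅ = On.poset null (proj₁ {B = λ N → ¬ (proj₁ N ≐ ∅)})

------------------------------------------------------------------------
-- Minimal sizes

-- A subset F as a setoid, with the equality of S. Elements of F that are
-- equal in S count once, so it is harmless that F need not respect _≈_.

module _ (S : Setoid a ℓ) where
  open Setoid S using (Carrier)

  elements : Subset Carrier → Setoid a ℓ
  elements F = On.setoid S (proj₁ {B = F})

  -- Cardinals are represented by setoids: κ is the minimal size of an
  -- F ⊆ S with property Φ. By Cantor–Schröder–Bernstein, such a κ is
  -- classically unique up to bijection. That one exists whenever some F
  -- satisfies Φ uses choice, which stdlib's ExcludedMiddle, deciding
  -- arbitrary types, supplies.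

  IsMinimalSize : Pred (Subset Carrier) p → Setoid a ℓ →
                  Set (a ⊔ ℓ ⊔ p ⊔ lsuc 0ℓ)
  IsMinimalSize Φ κ =
      (∃[ F ] Φ F × Bijection κ (elements F))
    × (∀ G → Φ G → Injection κ (elements G))

module _ (P : Poset c ℓ₁ ℓ₂) where
  open Poset P using (Carrier) renaming (_≤_ to _⊑_)

  IncomparableFamily : Subset Carrier → Set (c ⊔ ℓ₂)
  IncomparableFamily F = ∀ p → ∃[ q ] q ∈ F × ¬ (p ⊑ q) × ¬ (q ⊑ p)

  Is-𝔦𝔠𝔭 : Setoid c ℓ₁ → Set (c ⊔ ℓ₁ ⊔ ℓ₂ ⊔ lsuc 0ℓ)
  Is-𝔦𝔠𝔭 = IsMinimalSize (Poset.Eq.setoid P) IncomparableFamily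

⋃ : Subset (Poset.Carrier null) → Pred Cantor (lsuc 0ℓ)
⋃ F x = ∃[ N ] N ∈ F × x ∈ proj₁ N

Is-add-null : Setoid (lsuc 0ℓ) 0ℓ → Set (lsuc 0ℓ)
Is-add-null = IsMinimalSize (Poset.Eq.setoid null) (λ F → ¬ Null (⋃ F))

{-# OPTIONS --safe #-}
module Submission where

-- The union of an incomparable family F is not null: if it were, it would be
-- an element of the poset lying above every member of F. Conversely, if ⋃ G is
-- not null and M ∈ G is nonempty, then M together with the nonempty N ∖ M for
-- N ∈ G is an incomparable family: a null set disjoint from M is incomparable
-- with M, and one that meets M is included in no N ∖ M and cannot include all
-- of them. Hence an incomparable family of minimal size also has the minimal
-- size of a family with non-null union. Minimal sizes exist because every
-- nonempty family of sets has one that injects into all the others.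

open import Defs
open import Axiom.ExcludedMiddle using (ExcludedMiddle)
open import Axiom.Extensionality.Propositional using (Extensionality)
open import Data.Bool.Base using (Bool; true; false; T)
open import Data.Bool.Properties using (T-irrelevant)
open import Data.Empty using (⊥-elim)
open import Data.Fin.Base using (zero; suc)
import Data.Integer.Base as ℤ
import Data.Integer.Properties as ℤ
open import Data.List.Base using (List; []; _∷_; applyUpTo)
open import Data.List.Properties using (lookup-applyUpTo)
open import Data.Maybe.Base using (Maybe; just; nothing; maybe′)
open import Data.Nat.Base using (ℕ; zero; suc)
import Data.Nat.Base as ℕ
import Data.Nat.Properties as ℕ
open import Data.Product.Base using (∃; ∃-syntax; Σ-syntax; _×_; _,_; proj₁; proj₂; map₁; map₂)
open import Data.Rational.Base using (ℚ; mkℚ; 0ℚ; 1ℚ; ½; _+_; _*_; _≤_; _<_; *<*; toℚᵘ)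
open import Data.Rational.Properties
open import Data.Rational.Solver using (module +-*-Solver)
open import Data.Rational.Unnormalised.Base as ℚᵘ using (mkℚᵘ; *≤*)
import Data.Rational.Unnormalised.Properties as ℚᵘ
open import Data.Sum.Base using (_⊎_; inj₁; inj₂; [_,_]′)
open import Data.Unit.Base using (tt)
open import Function.Base using (_∘_; id; const; case_of_)
open import Function.Bundles using (Injection; Bijection)
import Function.Construct.Composition as Composition
import Function.Construct.Identity as Identity
open import Level using (Level; 0ℓ; _⊔_) renaming (suc to lsuc)
open import Relation.Binary.Bundles using (Setoid; Poset)
open import Relation.Binary.PropositionalEquality
open import Relation.Nullary using (¬_; yes; no; contradiction)
open import Relation.Nullary.Decidable using (True; isYes; decidable-stable; toWitness; fromWitness)
open import Relation.Unary using (Pred; _∈_; _⊆_; _≐_; _∪_; _∖_; ∅; ｛_｝; U)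
open import Relation.Unary.Properties using (≐-refl; ≐-sym; ≐-trans)

private
  variable
    a i p ℓ ℓ₁ ℓ₂ : Level
    A : Set a

-- Partial sums

partialSum-mono : ∀ {f : ℕ → ℚ} → (∀ n → 0ℚ ≤ f n) →
                  ∀ {m n} → m ℕ.≤′ n → partialSum f m ≤ partialSum f n
partialSum-mono 0≤f ℕ.≤′-refl = ≤-refl
partialSum-mono {f} 0≤f {m} {suc n} (ℕ.≤′-step m≤n) = begin
  partialSum f m       ≤⟨ partialSum-mono 0≤f m≤n ⟩
  partialSum f n       ≡⟨ +-identityʳ _ ⟨
  partialSum f n + 0ℚ  ≤⟨ +-monoʳ-≤ (partialSum f n) (0≤f n) ⟩
  partialSum f (suc n) ∎
  where open ≤-Reasoning

partialSum-nonNeg : ∀ {f : ℕ → ℚ} → (∀ n → 0ℚ ≤ f n) → ∀ n → 0ℚ ≤ partialSum f n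
partialSum-nonNeg 0≤f n = partialSum-mono 0≤f (ℕ.≤⇒≤′ (ℕ.z≤n {n}))

term≤partialSum : ∀ {f : ℕ → ℚ} → (∀ n → 0ℚ ≤ f n) → ∀ n → f n ≤ partialSum f (suc n)
term≤partialSum {f} 0≤f n = begin
  f n                  ≡⟨ +-identityˡ _ ⟨
  0ℚ + f n             ≤⟨ +-monoˡ-≤ (f n) (partialSum-nonNeg 0≤f n) ⟩
  partialSum f (suc n) ∎
  where open ≤-Reasoning

partialSum-suc : ∀ (f : ℕ → ℚ) n → partialSum f (suc n) ≡ f 0 + partialSum (f ∘ suc) n
partialSum-suc f zero    = +-comm 0ℚ (f 0)
partialSum-suc f (suc n) = begin
  partialSum f (suc n) + f (suc n)             ≡⟨ cong (_+ f (suc n)) (partialSum-suc f n) ⟩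
  (f 0 + partialSum (f ∘ suc) n) + f (suc n)   ≡⟨ +-assoc (f 0) _ _ ⟩
  f 0 + partialSum (f ∘ suc) (suc n)           ∎
  where open ≡-Reasoning

partialSum-average : ∀ {f g h : ℕ → ℚ} → (∀ n → f n ≡ ½ * (g n + h n)) →
                     ∀ n → partialSum f n ≡ ½ * (partialSum g n + partialSum h n)
partialSum-average eq zero = refl
partialSum-average {f} {g} {h} eq (suc n) = begin
  partialSum f n + f n                          ≡⟨ cong₂ _+_ (partialSum-average eq n) (eq n) ⟩
  ½ * (G + H) + ½ * (g n + h n)                 ≡⟨ rearrange G H (g n) (h n) ⟩
  ½ * ((G + g n) + (H + h n))                   ∎
  where
  open ≡-Reasoning
  open +-*-Solver
  G = partialSum g n
  H = partialSum h n
  rearrange : ∀ w x y z → ½ * (w + x) + ½ * (y + z) ≡ ½ * ((w + y) + (x + z))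
  rearrange = solve 4 (λ w x y z → con ½ :* (w :+ x) :+ con ½ :* (y :+ z)
                                 := con ½ :* ((w :+ y) :+ (x :+ z))) refl

½*-nonNeg : ∀ {q} → 0ℚ ≤ q → 0ℚ ≤ ½ * q
½*-nonNeg = *-monoˡ-≤-nonNeg ½

½*-pos : ∀ {q} → 0ℚ < q → 0ℚ < ½ * q
½*-pos = *-monoʳ-<-pos ½

½*q+½*q≡q : ∀ q → ½ * q + ½ * q ≡ q
½*q+½*q≡q = solve 1 (λ q → con ½ :* q :+ con ½ :* q := q) refl
  where open +-*-Solver

μ-nonNeg : ∀ s → 0ℚ ≤ μ s
μ-nonNeg []      = nonNegative⁻¹ 1ℚ
μ-nonNeg (_ ∷ s) = ½*-nonNeg (μ-nonNeg s)

-- Null sets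

Null-⊆ : {A : Pred Cantor ℓ₁} {B : Pred Cantor ℓ₂} → A ⊆ B → Null B → Null A
Null-⊆ A⊆B nullB ε ε>0 = let s , B⊆s , ≤ε = nullB ε ε>0 in s , B⊆s ∘ A⊆B , ≤ε

interleave : (ℕ → A) → (ℕ → A) → ℕ → A
interleave f g zero    = f 0
interleave f g (suc n) = interleave g (f ∘ suc) n

interleave-left  : ∀ (f g : ℕ → A) n → ∃[ m ] interleave f g m ≡ f n
interleave-right : ∀ (f g : ℕ → A) n → ∃[ m ] interleave f g m ≡ g n
interleave-left f g zero    = 0 , refl
interleave-left f g (suc n) = let m , eq = interleave-right g (f ∘ suc) n in suc m , eq
interleave-right f g n      = let m , eq = interleave-left g (f ∘ suc) n in suc m , eq

-- The first `n` terms of the interleaving use at most `n` terms of each sequence. The induction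
-- follows the swap of roles in `interleave`.
partialSum-interleave : {w : A → ℚ} → (∀ x → 0ℚ ≤ w x) → ∀ f g n →
  partialSum (w ∘ interleave f g) n ≤ partialSum (w ∘ f) n + partialSum (w ∘ g) n
partialSum-interleave 0≤w f g zero = ≤-refl
partialSum-interleave {w = w} 0≤w f g (suc n) = begin
  partialSum (w ∘ interleave f g) (suc n)
    ≡⟨ partialSum-suc (w ∘ interleave f g) n ⟩
  w (f 0) + partialSum (w ∘ interleave g (f ∘ suc)) n
    ≤⟨ +-monoʳ-≤ (w (f 0)) (partialSum-interleave 0≤w g (f ∘ suc) n) ⟩
  w (f 0) + (partialSum (w ∘ g) n + partialSum (w ∘ f ∘ suc) n)
    ≡⟨ rearrange (w (f 0)) (partialSum (w ∘ g) n) _ ⟩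
  (w (f 0) + partialSum (w ∘ f ∘ suc) n) + partialSum (w ∘ g) n
    ≡⟨ cong (_+ partialSum (w ∘ g) n) (partialSum-suc (w ∘ f) n) ⟨
  partialSum (w ∘ f) (suc n) + partialSum (w ∘ g) n
    ≤⟨ +-monoʳ-≤ (partialSum (w ∘ f) (suc n))
         (partialSum-mono (0≤w ∘ g) (ℕ.≤′-step (ℕ.≤′-refl {n}))) ⟩
  partialSum (w ∘ f) (suc n) + partialSum (w ∘ g) (suc n)
    ∎
  where
  open ≤-Reasoning
  open +-*-Solver
  rearrange : ∀ x y z → x + (y + z) ≡ (x + z) + y
  rearrange = solve 3 (λ x y z → x :+ (y :+ z) := (x :+ z) :+ y) refl

Null-∪ : {A : Pred Cantor ℓ₁} {B : Pred Cantor ℓ₂} → Null A → Null B → Null (A ∪ B)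
Null-∪ {A = A} {B} nullA nullB ε ε>0
  with s , A⊆s , s≤ ← nullA (½ * ε) (½*-pos ε>0)
     | t , B⊆t , t≤ ← nullB (½ * ε) (½*-pos ε>0)
  = interleave s t , covers , bounded
  where
  open ≤-Reasoning
  covers : A ∪ B ⊆ λ x → ∃[ n ] x ∈ Cylinder (interleave s t n)
  covers {x} (inj₁ x∈A) =
    let n , x∈s = A⊆s x∈A ; m , eq = interleave-left s t n
    in m , subst (λ u → x ∈ Cylinder u) (sym eq) x∈s
  covers {x} (inj₂ x∈B) =
    let n , x∈t = B⊆t x∈B ; m , eq = interleave-right s t n
    in m , subst (λ u → x ∈ Cylinder u) (sym eq) x∈t
  bounded : ∀ n → partialSum (μ ∘ interleave s t) n ≤ ε
  bounded n = begin
    partialSum (μ ∘ interleave s t) n            ≤⟨ partialSum-interleave μ-nonNeg s t n ⟩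
    partialSum (μ ∘ s) n + partialSum (μ ∘ t) n  ≤⟨ +-mono-≤ (s≤ n) (t≤ n) ⟩
    ½ * ε + ½ * ε                                ≡⟨ ½*q+½*q≡q ε ⟩
    ε                                            ∎

-- Singletons are null

½^_ : ℕ → ℚ
½^ zero  = 1ℚ
½^ suc n = ½ * ½^ n

½^-nonNeg : ∀ n → 0ℚ ≤ ½^ n
½^-nonNeg zero    = nonNegative⁻¹ 1ℚ
½^-nonNeg (suc n) = ½*-nonNeg (½^-nonNeg n)

μ-applyUpTo : ∀ x n → μ (applyUpTo x n) ≡ ½^ n
μ-applyUpTo x zero    = refl
μ-applyUpTo x (suc n) = cong (½ *_) (μ-applyUpTo (x ∘ suc) n)

-- Induction, since `2 + n ≤ 2 * (1 + n)`. With unnormalised rationals the bound is a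
-- cross-multiplication of integers.
½^n≤1/[1+n] : ∀ n → toℚᵘ (½^ n) ℚᵘ.≤ mkℚᵘ (ℤ.+ 1) n
½^n≤1/[1+n] zero    = ℚᵘ.≤-refl
½^n≤1/[1+n] (suc n) = begin
  toℚᵘ (½ * ½^ n)               ≃⟨ toℚᵘ-homo-* ½ (½^ n) ⟩
  ℚᵘ.½ ℚᵘ.* toℚᵘ (½^ n)         ≤⟨ ℚᵘ.*-monoʳ-≤-nonNeg ℚᵘ.½ (½^n≤1/[1+n] n) ⟩
  ℚᵘ.½ ℚᵘ.* mkℚᵘ (ℤ.+ 1) n      ≤⟨ *≤* (ℤ.*-monoˡ-≤-nonNeg (ℤ.+ 1) (ℤ.+≤+ 2+n≤2[1+n])) ⟩
  mkℚᵘ (ℤ.+ 1) (suc n)          ∎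
  where
  open ℚᵘ.≤-Reasoning
  2+n≤2[1+n] : suc (suc n) ℕ.≤ 2 ℕ.* suc n
  2+n≤2[1+n] = subst (λ k → suc (suc n) ℕ.≤ suc k) (sym (ℕ.+-suc n (n ℕ.+ 0)))
                 (ℕ.s≤s (ℕ.s≤s (ℕ.m≤m+n n _)))

∃½^n≤ε : ∀ ε → 0ℚ < ε → ∃[ n ] ½^ n ≤ ε
∃½^n≤ε (mkℚ (ℤ.+ zero)  d _) (*<* (ℤ.+<+ ()))
∃½^n≤ε (mkℚ ℤ.-[1+ _ ] d _) (*<* ())
-- Here `ε` is `(1 + m) / (1 + d)`, so `½^ d ≤ 1 / (1 + d) ≤ ε`.
∃½^n≤ε (mkℚ (ℤ.+ suc m) d _) _ = d , toℚᵘ-cancel-≤ (ℚᵘ.≤-trans (½^n≤1/[1+n] d)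
  (*≤* (ℤ.*-monoʳ-≤-nonNeg (ℤ.+ suc d) (ℤ.+≤+ (ℕ.s≤s (ℕ.z≤n {m}))))))

-- A cover consists of infinitely many cylinders of positive measure. The prefixes of `x` of lengths
-- `k + 1`, `k + 2`, ... serve: the partial sums of their measures are at most `½^ k ≤ ε`.
Null-｛_｝ : ∀ x → Null ｛ x ｝
Null-｛ x ｝ ε ε>0 with k , ½^k≤ε ← ∃½^n≤ε ε ε>0
  = s , (λ { refl → 0 , λ i → sym (lookup-applyUpTo x _ i) }) , bounded
  where
  s : ℕ → List Bool
  s n = applyUpTo x (suc n ℕ.+ k)
  telescope : ∀ n → partialSum (μ ∘ s) n + ½^ (n ℕ.+ k) ≡ ½^ k
  telescope zero    = +-identityˡ (½^ k)
  telescope (suc n) = begin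
    (S + μ (s n)) + ½^ (suc n ℕ.+ k)
      ≡⟨ cong (λ q → (S + q) + ½^ (suc n ℕ.+ k)) (μ-applyUpTo x (suc n ℕ.+ k)) ⟩
    (S + ½^ (suc n ℕ.+ k)) + ½^ (suc n ℕ.+ k)
      ≡⟨ +-assoc S _ _ ⟩
    S + (½ * ½^ (n ℕ.+ k) + ½ * ½^ (n ℕ.+ k))
      ≡⟨ cong (S +_) (½*q+½*q≡q (½^ (n ℕ.+ k))) ⟩
    S + ½^ (n ℕ.+ k)
      ≡⟨ telescope n ⟩
    ½^ k
      ∎
    where
    open ≡-Reasoning
    S = partialSum (μ ∘ s) n
  bounded : ∀ n → partialSum (μ ∘ s) n ≤ ε
  bounded n = begin
    partialSum (μ ∘ s) n                    ≡⟨ +-identityʳ _ ⟨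
    partialSum (μ ∘ s) n + 0ℚ               ≤⟨ +-monoʳ-≤ (partialSum (μ ∘ s) n) (½^-nonNeg (n ℕ.+ k)) ⟩
    partialSum (μ ∘ s) n + ½^ (n ℕ.+ k)     ≡⟨ telescope n ⟩
    ½^ k                                    ≤⟨ ½^k≤ε ⟩
    ε                                       ∎
    where open ≤-Reasoning

-- 2^ω is not null: following a half of relative cover weight at most ½ at each
-- bit leads to a point outside every cylinder of the cover.

-- just s and nothing stand for Cylinder s and the empty set.
weight : Maybe (List Bool) → ℚ
weight = maybe′ μ 0ℚ

weight-nonNeg : ∀ r → 0ℚ ≤ weight r
weight-nonNeg (just s) = μ-nonNeg s
weight-nonNeg nothing  = ≤-refl

-- A point `b ∷ x` lies in the set coded by `r` exactly when `x` lies in that coded by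
-- `residual b r`. The empty word codes all of 2^ω and therefore stays.
residual : Bool → Maybe (List Bool) → Maybe (List Bool)
residual _     nothing            = nothing
residual _     (just [])          = just []
residual false (just (false ∷ s)) = just s
residual false (just (true  ∷ s)) = nothing
residual true  (just (false ∷ s)) = nothing
residual true  (just (true  ∷ s)) = just s

residual-∷ : ∀ b s → residual b (just (b ∷ s)) ≡ just s
residual-∷ false s = refl
residual-∷ true  s = refl

weight-residual : ∀ r → weight r ≡ ½ * (weight (residual false r) + weight (residual true r))
weight-residual nothing            = refl
weight-residual (just [])          = refl
weight-residual (just (false ∷ s)) = cong (½ *_) (sym (+-identityʳ (μ s)))
weight-residual (just (true  ∷ s)) = cong (½ *_) (sym (+-identityˡ (μ s)))

-- The bound ½ is strictly below the weight 1 of the whole space.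
Sparse : (ℕ → Maybe (List Bool)) → Set
Sparse c = ∀ n → partialSum (weight ∘ c) n ≤ ½

module _ (em : ∀ {ℓ} → ExcludedMiddle ℓ) where

  -- The weights of the two halves average to that of `c`. If one exceeds ½ after `m` terms and the
  -- other after `n`, both do after `m + n`, and so does their average.
  sparse-residual : ∀ c → Sparse c → ∃[ b ] Sparse (residual b ∘ c)
  sparse-residual c sparse with em {P = Sparse (residual false ∘ c)}
  ... | yes sparse₀ = false , sparse₀
  ... | no ¬sparse₀ = true , λ n → decidable-stable em λ ≰½ → ¬sparse₀ λ m →
    decidable-stable em λ ≰½′ → <-irrefl refl (begin-strict
      ½
        ≡⟨⟩
      ½ * (½ + ½)
        <⟨ *-monoʳ-<-pos ½ (+-mono-< (above false m (m ℕ.+ n) (ℕ.m≤m+n m n) (≰⇒> ≰½′))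
                                     (above true n (m ℕ.+ n) (ℕ.m≤n+m n m) (≰⇒> ≰½))) ⟩
      ½ * (sum false (m ℕ.+ n) + sum true (m ℕ.+ n))
        ≡⟨ partialSum-average (weight-residual ∘ c) (m ℕ.+ n) ⟨
      partialSum (weight ∘ c) (m ℕ.+ n)
        ≤⟨ sparse (m ℕ.+ n) ⟩
      ½
        ∎)
    where
    open ≤-Reasoning
    sum : Bool → ℕ → ℚ
    sum b = partialSum (weight ∘ residual b ∘ c)
    above : ∀ b m n → m ℕ.≤ n → ½ < sum b m → ½ < sum b n
    above b m n m≤n ½< = <-≤-trans ½<
      (partialSum-mono (weight-nonNeg ∘ residual b ∘ c) (ℕ.≤⇒≤′ m≤n))

  escape : ∀ c → Sparse c → Cantor
  escape c sparse zero    = proj₁ (sparse-residual c sparse)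
  escape c sparse (suc n) =
    escape (residual (proj₁ (sparse-residual c sparse)) ∘ c) (proj₂ (sparse-residual c sparse)) n

  -- Induction on `s`: each bit shared with the escaping point strips one bit from the `n`-th
  -- cylinder. Once none is left, that cylinder has weight 1, too much for a sparse cover.
  escape-∉ : ∀ c (sparse : Sparse c) n s → c n ≡ just s → ¬ escape c sparse ∈ Cylinder s
  escape-∉ c sparse n [] cn≡ _ = <-irrefl refl (begin-strict
    ½                               <⟨ toWitness {a? = ½ <? 1ℚ} _ ⟩
    1ℚ                              ≡⟨ cong weight cn≡ ⟨
    weight (c n)                    ≤⟨ term≤partialSum (weight-nonNeg ∘ c) n ⟩
    partialSum (weight ∘ c) (suc n) ≤⟨ sparse (suc n) ⟩
    ½                               ∎)
    where open ≤-Reasoning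
  escape-∉ c sparse n (b ∷ s) cn≡ x∈ =
    escape-∉ (residual b′ ∘ c) (proj₂ (sparse-residual c sparse)) n s
      (trans (cong₂ residual (x∈ zero) cn≡) (residual-∷ b s)) (x∈ ∘ suc)
    where b′ = proj₁ (sparse-residual c sparse)

  ¬Null-full : {A : Pred Cantor ℓ} → (∀ x → x ∈ A) → ¬ Null A
  ¬Null-full full nullA with s , A⊆s , s≤½ ← nullA ½ (positive⁻¹ ½) =
    let n , x∈s = A⊆s (full (escape (just ∘ s) s≤½))
    in escape-∉ (just ∘ s) s≤½ n (s n) refl x∈s

module _ (em : ∀ {ℓ} → ExcludedMiddle ℓ) (ext : ∀ {a b} → Extensionality a b) where

  -- Boolean-valued subsets: extensional up to _≡_ and closed under unions
  -- without raising universe levels.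

  ⌊_⌋ : Pred A p → A → Bool
  ⌊ P ⌋ x = isYes (em {P = P x})

  infix 4 _∈ᵇ_ _⊑_

  _∈ᵇ_ : A → (A → Bool) → Set
  x ∈ᵇ X = T (X x)

  _⊑_ : (X Y : A → Bool) → Set _
  X ⊑ Y = ∀ x → x ∈ᵇ X → x ∈ᵇ Y

  ⊑-antisym : {X Y : A → Bool} → X ⊑ Y → Y ⊑ X → X ≡ Y
  ⊑-antisym {X = X} {Y} X⊑Y Y⊑X = ext λ x → T-injective (X x) (Y x) (X⊑Y x) (Y⊑X x)
    where
    T-injective : ∀ b c → (T b → T c) → (T c → T b) → b ≡ c
    T-injective false false _ _ = refl
    T-injective false true  _ g = ⊥-elim (g tt)
    T-injective true  false f _ = ⊥-elim (f tt)
    T-injective true  true  _ _ = refl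

  choose : (X : A → Bool) → True (em {P = ∃ (_∈ᵇ X)}) → A
  choose X = proj₁ ∘ toWitness

  choose-∈ : ∀ (X : A → Bool) nonempty → choose X nonempty ∈ᵇ X
  choose-∈ X nonempty = proj₂ (toWitness nonempty)

  -- `True` is proof-irrelevant, so the chosen element depends on the set alone and not on the
  -- evidence that it is inhabited.
  choose-cong : ∀ {X Y : A → Bool} {p q} → X ≡ Y → choose X p ≡ choose Y q
  choose-cong refl = cong (choose _) (T-irrelevant _ _)

  -- The Bourbaki–Witt theorem for inflationary maps on subsets

  module Tower {A : Set a} (f : (A → Bool) → (A → Bool))
               (f-inflationary : ∀ X → X ⊑ f X) where

    ⋃ᵇ : ((A → Bool) → Bool) → A → Bool
    ⋃ᵇ F = ⌊ (λ x → ∃[ X ] X ∈ᵇ F × x ∈ᵇ X) ⌋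

    -- The tower generated by `f`; its bottom is the union of the empty family.
    data Stage : (A → Bool) → Set a where
      next  : ∀ {X} → Stage X → Stage (f X)
      union : ∀ {F} → (∀ {X} → X ∈ᵇ F → Stage X) → Stage (⋃ᵇ F)

    Extreme : (A → Bool) → Set a
    Extreme X = ∀ {Y} → Stage Y → Y ⊑ X → ¬ (X ⊑ Y) → f Y ⊑ X

    extreme⇒comparable : ∀ {X Y} → Extreme X → Stage Y → Y ⊑ X ⊎ f X ⊑ Y
    extreme⇒comparable {X} extreme (next {Y} sY) with extreme⇒comparable extreme sY
    ... | inj₂ fX⊑Y = inj₂ λ x → f-inflationary Y x ∘ fX⊑Y x
    ... | inj₁ Y⊑X with em {P = X ⊑ Y}
    -- `f` is not assumed monotone, so mutual inclusion is first turned into `X ≡ Y`.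
    ...   | yes X⊑Y = inj₂ (subst (λ Z → f X ⊑ f Z) (⊑-antisym X⊑Y Y⊑X) λ _ → id)
    ...   | no  X⋢Y = inj₁ (extreme sY Y⊑X X⋢Y)
    extreme⇒comparable {X} extreme (union {F} sF) with em {P = ∃[ Y ] Y ∈ᵇ F × f X ⊑ Y}
    ... | yes (Y , Y∈F , fX⊑Y) = inj₂ λ x x∈ → fromWitness (Y , Y∈F , fX⊑Y x x∈)
    ... | no ¬above = inj₁ λ x x∈ → let Y , Y∈F , x∈Y = toWitness x∈ in
      [ (λ Y⊑X → Y⊑X x x∈Y) , (λ fX⊑Y → contradiction (Y , Y∈F , fX⊑Y) ¬above) ]′
        (extreme⇒comparable extreme (sF Y∈F))

    stage-extreme : ∀ {X} → Stage X → Extreme X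
    stage-extreme (next {X} sX) {Y} sY Y⊑fX fX⋢Y
      with extreme⇒comparable (stage-extreme sX) sY
    ... | inj₂ fX⊑Y = contradiction fX⊑Y fX⋢Y
    ... | inj₁ Y⊑X with em {P = X ⊑ Y}
    ...   | yes X⊑Y = subst (λ Z → f Y ⊑ f Z) (⊑-antisym Y⊑X X⊑Y) λ _ → id
    ...   | no  X⋢Y = λ x → f-inflationary X x ∘ stage-extreme sX sY Y⊑X X⋢Y x
    stage-extreme (union {F} sF) {Y} sY Y⊑⋃F ⋃F⋢Y with em {P = ∃[ X ] X ∈ᵇ F × ¬ (X ⊑ Y)}
    ... | no ¬∃ = contradiction ⋃F⊑Y ⋃F⋢Y
      where
      ⋃F⊑Y : ⋃ᵇ F ⊑ Y
      ⋃F⊑Y x x∈ = let X , X∈F , x∈X = toWitness x∈ in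
        decidable-stable em λ x∉Y → ¬∃ (X , X∈F , λ X⊑Y → x∉Y (X⊑Y x x∈X))
    -- `X ⋢ Y` excludes `f X ⊑ Y`, so `Y` lies strictly below the member `X` of the union, and
    -- extremality of `X` bounds `f Y`.
    ... | yes (X , X∈F , X⋢Y) with extreme⇒comparable (stage-extreme (sF X∈F)) sY
    ...   | inj₂ fX⊑Y = contradiction (λ x → fX⊑Y x ∘ f-inflationary X x) X⋢Y
    ...   | inj₁ Y⊑X  = λ x x∈ → fromWitness (X , X∈F , stage-extreme (sF X∈F) sY Y⊑X X⋢Y x x∈)

    stage-total : ∀ {X Y} → Stage X → Stage Y → X ⊑ Y ⊎ Y ⊑ X
    stage-total {X} sX sY with extreme⇒comparable (stage-extreme sX) sY
    ... | inj₁ Y⊑X  = inj₂ Y⊑X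
    ... | inj₂ fX⊑Y = inj₁ λ x → fX⊑Y x ∘ f-inflationary X x

    -- The union of all stages is itself a stage, so `f last` is among the sets united. This makes
    -- `last` a fixed point.
    last : A → Bool
    last = ⋃ᵇ ⌊ Stage ⌋

    last-stage : Stage last
    last-stage = union toWitness

    last-fixed : f last ⊑ last
    last-fixed x x∈ = fromWitness (f last , fromWitness (next last-stage) , x∈)

  -- Hönig's proof of the comparability of cardinals: a maximal set of choice
  -- functions on which every evaluation is injective has a surjective evaluation.

  module Smallest {I : Set i} (S : I → Setoid a ℓ) (i₀ : I) where

    private
      module S i = Setoid (S i)

    Choice : Set (i ⊔ a)
    Choice = ∀ i → S.Carrier i

    Fresh : (Choice → Bool) → Choice → Set (a ⊔ i ⊔ ℓ)
    Fresh X x = ∀ i {y} → y ∈ᵇ X → ¬ S._≈_ i (x i) (y i)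

    fresh? : (Choice → Bool) → Set
    fresh? X = True (em {P = ∃ (_∈ᵇ ⌊ Fresh X ⌋)})

    Extension : (Choice → Bool) → Pred Choice _
    Extension X y = y ∈ᵇ X ⊎ (Σ[ t ∈ fresh? X ] y ≡ choose ⌊ Fresh X ⌋ t)

    open Tower {A = Choice} (λ X → ⌊ Extension X ⌋) (λ X x → fromWitness ∘ inj₁)

    -- As `i` and `j` are arbitrary, this says at once that the partial map taking `x i` to `x j` is
    -- well defined and that it is injective.
    Coherent : (Choice → Bool) → Set _
    Coherent X = ∀ {x y} → x ∈ᵇ X → y ∈ᵇ X → ∀ {i j} → S._≈_ i (x i) (y i) → S._≈_ j (x j) (y j)

    -- The added function agrees with no earlier one at any coordinate, and only one is added.
    extension-coherent : ∀ {X} → Coherent X → Coherent ⌊ Extension X ⌋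
    extension-coherent {X} coherent x∈ y∈ {i} {j} x≈y with toWitness x∈ | toWitness y∈
    ... | inj₁ x∈X        | inj₁ y∈X        = coherent x∈X y∈X x≈y
    ... | inj₁ x∈X        | inj₂ (t , refl) =
      contradiction (S.sym i x≈y) (toWitness (choose-∈ ⌊ Fresh X ⌋ t) i x∈X)
    ... | inj₂ (t , refl) | inj₁ y∈X        =
      contradiction x≈y (toWitness (choose-∈ ⌊ Fresh X ⌋ t) i y∈X)
    ... | inj₂ (t , refl) | inj₂ (u , refl) =
      S.reflexive j (cong (λ z → z j) (choose-cong {X = ⌊ Fresh X ⌋} refl))

    stage-coherent : ∀ {X} → Stage X → Coherent X
    stage-coherent (next sX)  = extension-coherent (stage-coherent sX)
    stage-coherent (union sF) x∈ y∈ x≈y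
      with X , X∈F , x∈X ← toWitness x∈ | Y , Y∈F , y∈Y ← toWitness y∈
      with stage-total (sF X∈F) (sF Y∈F)
    ... | inj₁ X⊑Y = stage-coherent (sF Y∈F) (X⊑Y _ x∈X) y∈Y x≈y
    ... | inj₂ Y⊑X = stage-coherent (sF X∈F) x∈X (Y⊑X _ y∈Y) x≈y

    Exhausted : I → Set _
    Exhausted i = ∀ s → ∃[ x ] x ∈ᵇ last × S._≈_ i s (x i)

    -- If no evaluation is onto, values missed at the various coordinates form a fresh function.
    -- Then the chosen fresh function lies in the fixed point `last`, so it would differ from itself
    -- at `i₀`.
    ∃-exhausted : ∃ Exhausted
    ∃-exhausted = decidable-stable em λ ¬exhausted →
      let
        unhit : ∀ i → ∃[ s ] ¬ (∃[ x ] x ∈ᵇ last × S._≈_ i s (x i))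
        unhit i = decidable-stable em λ ¬unhit → ¬exhausted
          (i , λ s → decidable-stable em λ s-unhit → ¬unhit (s , s-unhit))
        x : Choice
        x = proj₁ ∘ unhit
        fresh : fresh? last
        fresh = fromWitness (x , fromWitness λ i {y} y∈ x≈y → proj₂ (unhit i) (y , y∈ , x≈y))
        y = choose ⌊ Fresh last ⌋ fresh
        y∈last = last-fixed y (fromWitness (inj₂ (fresh , refl)))
      in toWitness (choose-∈ ⌊ Fresh last ⌋ fresh) i₀ y∈last (S.refl i₀)

    exhausted⇒injects : ∀ {i} → Exhausted i → ∀ j → Injection (S i) (S j)
    exhausted⇒injects {i} exhausted j = record
      { to        = λ s → proj₁ (exhausted s) j
      ; cong      = λ {s} {t} s≈t →
          let x , x∈ , s≈x = exhausted s ; y , y∈ , t≈y = exhausted t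
          in coherent x∈ y∈ (S.trans i (S.sym i s≈x) (S.trans i s≈t t≈y))
      ; injective = λ {s} {t} x≈y →
          let x , x∈ , s≈x = exhausted s ; y , y∈ , t≈y = exhausted t
          in S.trans i s≈x (S.trans i (coherent x∈ y∈ x≈y) (S.sym i t≈y))
      }
      where
      coherent : Coherent last
      coherent = stage-coherent last-stage

    smallest : ∃[ i ] ∀ j → Injection (S i) (S j)
    smallest = map₂ exhausted⇒injects ∃-exhausted

  -- Applies `smallest` to all subsets with property `Φ`, indexed by themselves.
  ∃-minimal-size : ∀ (S : Setoid a ℓ) {Φ : Pred (Subset (Setoid.Carrier S)) p} →
    ∃ Φ → ∃[ F ] Φ F × IsMinimalSize S Φ (elements S F)
  ∃-minimal-size S {Φ} nonempty = F , ΦF , (F , ΦF , Identity.bijection (elements S F)) ,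
    λ G ΦG → proj₂ least (G , ΦG)
    where
    least : ∃[ G ] ∀ H → Injection (elements S (proj₁ G)) (elements S (proj₁ H))
    least = Smallest.smallest {I = ∃ Φ} (elements S ∘ proj₁) nonempty
    F  = proj₁ (proj₁ least)
    ΦF = proj₂ (proj₁ least)

  -- Incomparable families of null sets

  NullSet NonemptyNullSet : Set₁
  NullSet         = Poset.Carrier null
  NonemptyNullSet = Poset.Carrier null∖∅

  nullSetoid nonemptyNullSetoid : Setoid (lsuc 0ℓ) 0ℓ
  nullSetoid         = Poset.Eq.setoid null
  nonemptyNullSetoid = Poset.Eq.setoid null∖∅

  forget : Subset NonemptyNullSet → Subset NullSet
  forget F N = Σ[ ne ∈ ¬ (proj₁ N ≐ ∅) ] F (N , ne)

  incomparable⇒union-not-null : ∀ {F} → IncomparableFamily null∖∅ F → ¬ Null (⋃ (forget F))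
  incomparable⇒union-not-null {F} inc null⋃ =
    let q , q∈F , _ , q⊈⋃F = inc ((⋃F , null-⋃F) , ⋃F≢∅) in q⊈⋃F (⊆⋃F q∈F)
    where
    -- `⋃` lands one universe up; its Boolean version is at level 0 and can be an element of the
    -- poset.
    ⋃F : Subset Cantor
    ⋃F x = x ∈ᵇ ⌊ ⋃ (forget F) ⌋

    null-⋃F : Null ⋃F
    null-⋃F = Null-⊆ toWitness null⋃

    ⊆⋃F : ∀ {q} → q ∈ F → proj₁ (proj₁ q) ⊆ ⋃F
    ⊆⋃F {N , ne} q∈F x∈N = fromWitness (N , (ne , q∈F) , x∈N)

    -- Applying the hypothesis to some element, here a singleton, produces a member of `F`. It is
    -- nonempty, hence so is the union.
    singleton : NonemptyNullSet
    singleton = (｛ const true ｝ , Null-｛ const true ｝) , λ (⊆∅ , _) → ⊆∅ refl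

    ⋃F≢∅ : ¬ (⋃F ≐ ∅)
    ⋃F≢∅ (⊆∅ , _) = let q , q∈F , _ = inc singleton in
      proj₂ q ((λ x∈q → ⊆∅ (⊆⋃F q∈F x∈q)) , λ ())

  -- From non-null unions to incomparable families

  ∃-nonempty-member : ∀ {G} → ¬ Null (⋃ G) → ∃[ M ] M ∈ G × ¬ (proj₁ M ≐ ∅)
  -- If all members were empty, their union would lie in every null set, such as a singleton.
  ∃-nonempty-member ¬null⋃ = decidable-stable em λ ¬∃ → ¬null⋃ (Null-⊆
    (λ (N , N∈G , x∈N) → contradiction (N , N∈G , λ (⊆∅ , _) → ⊆∅ x∈N) ¬∃)
    Null-｛ const true ｝)

  module Separate {G : Subset NullSet} (¬null⋃ : ¬ Null (⋃ G))
                  {M : NullSet} (M∈G : M ∈ G) (M≢∅ : ¬ (proj₁ M ≐ ∅)) where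

    -- The constructors exclude each other: if `N ≐ M`, the difference is empty, while `q` is not.
    -- So `N` determines `q` up to `≐`, which makes the choice of sources injective.
    data Yields (N : NullSet) (q : NonemptyNullSet) : Set where
      itself     : proj₁ N ≐ proj₁ M → proj₁ (proj₁ q) ≐ proj₁ M → Yields N q
      difference : proj₁ (proj₁ q) ≐ proj₁ N ∖ proj₁ M → Yields N q

    Source : NonemptyNullSet → Pred NullSet 0ℓ
    Source q N = N ∈ G × Yields N q

    -- `True` brings the existence of a source, a statement in a higher universe, down to level 0
    -- and into the form that `choose` takes.
    separated : Subset NonemptyNullSet
    separated q = True (em {P = ∃ (_∈ᵇ ⌊ Source q ⌋)})

    -- Otherwise every `N ∈ G` is included in `p ∪ M`, and `⋃ G` would be null.
    escaping : ∀ (p : Subset Cantor) → Null p → ∃[ N ] N ∈ G × ¬ (proj₁ N ∖ proj₁ M ⊆ p)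
    escaping p null-p = decidable-stable em λ ¬∃ → ¬null⋃ (Null-⊆
      (λ (N , N∈G , x∈N) → decidable-stable em λ x∉ →
        ¬∃ (N , N∈G , λ N∖M⊆p → x∉ (inj₁ (N∖M⊆p (x∈N , x∉ ∘ inj₂)))))
      (Null-∪ null-p (proj₂ M)))

    ∈-separated : ∀ q {N} → N ∈ G → Yields N q → q ∈ separated
    ∈-separated q {N} N∈G yields = fromWitness (N , fromWitness (N∈G , yields))

    _∖M : NullSet → NullSet
    N ∖M = proj₁ N ∖ proj₁ M , Null-⊆ proj₁ (proj₂ N)

    IncomparableMember : Subset Cantor → Set₁
    IncomparableMember p =
      ∃[ q ] q ∈ separated × ¬ (p ⊆ proj₁ (proj₁ q)) × ¬ (proj₁ (proj₁ q) ⊆ p)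

    disjoint⇒incomparable : ∀ {p} → ¬ (p ≐ ∅) → ¬ (∃[ x ] x ∈ p × x ∈ proj₁ M) →
                            IncomparableMember p
    disjoint⇒incomparable p≢∅ disjoint =
      (M , M≢∅)
      , ∈-separated (M , M≢∅) M∈G (itself ≐-refl ≐-refl)
      , (λ p⊆M → p≢∅ ((λ {x} x∈p → disjoint (x , x∈p , p⊆M x∈p)) , λ ()))
      , (λ M⊆p → M≢∅ ((λ {x} x∈M → disjoint (x , M⊆p x∈M , x∈M)) , λ ()))

    meets⇒incomparable : ∀ {p x} → x ∈ p → x ∈ proj₁ M →
      ∀ {N} → N ∈ G → ¬ (proj₁ N ∖ proj₁ M ⊆ p) → IncomparableMember p
    meets⇒incomparable x∈p x∈M {N} N∈G N∖M⊈p =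
      (N ∖M , N∖M≢∅)
      , ∈-separated (N ∖M , N∖M≢∅) N∈G (difference ≐-refl)
      , (λ p⊆N∖M → proj₂ (p⊆N∖M x∈p) x∈M)
      , N∖M⊈p
      where
      N∖M≢∅ : ¬ (proj₁ (N ∖M) ≐ ∅)
      N∖M≢∅ (⊆∅ , _) = N∖M⊈p λ x∈ → ⊥-elim (⊆∅ x∈)

    separated-incomparable : IncomparableFamily null∖∅ separated
    separated-incomparable ((p , null-p) , p≢∅) =
      case em {P = ∃[ x ] x ∈ p × x ∈ proj₁ M} of λ where
        (no disjoint) → disjoint⇒incomparable p≢∅ disjoint
        (yes (x , x∈p , x∈M)) →
          let N , N∈G , N∖M⊈p = escaping p null-p in meets⇒incomparable x∈p x∈M N∈G N∖M⊈p

    Yields-cong : ∀ {N q r} → proj₁ (proj₁ q) ≐ proj₁ (proj₁ r) → Yields N q → Yields N r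
    Yields-cong q≐r (itself N≐M q≐M) = itself N≐M (≐-trans (≐-sym q≐r) q≐M)
    Yields-cong q≐r (difference q≐N∖M) = difference (≐-trans (≐-sym q≐r) q≐N∖M)

    difference-empty : ∀ {N X : Subset Cantor} → N ≐ proj₁ M → X ≐ N ∖ proj₁ M → X ≐ ∅
    difference-empty (N⊆M , _) (X⊆N∖M , _) =
      (λ x∈X → let x∈N , x∉M = X⊆N∖M x∈X in x∉M (N⊆M x∈N)) , λ ()

    Yields-functional : ∀ {N N′ q r} → proj₁ N ≐ proj₁ N′ → Yields N q → Yields N′ r →
                        proj₁ (proj₁ q) ≐ proj₁ (proj₁ r)
    Yields-functional N≐N′ (itself _ q≐M) (itself _ r≐M) = ≐-trans q≐M (≐-sym r≐M)
    Yields-functional {r = r} N≐N′ (itself N≐M _) (difference r≐N′∖M) =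
      contradiction (difference-empty (≐-trans (≐-sym N≐N′) N≐M) r≐N′∖M) (proj₂ r)
    Yields-functional {q = q} N≐N′ (difference q≐N∖M) (itself N′≐M _) =
      contradiction (difference-empty (≐-trans N≐N′ N′≐M) q≐N∖M) (proj₂ q)
    Yields-functional (N⊆N′ , N′⊆N) (difference (q⊆N∖M , N∖M⊆q)) (difference (r⊆N′∖M , N′∖M⊆r)) =
      N′∖M⊆r ∘ map₁ N⊆N′ ∘ q⊆N∖M , N∖M⊆q ∘ map₁ N′⊆N ∘ r⊆N′∖M

    -- Choosing from ⌊ Source q ⌋ makes the source depend on q only up to ≐.
    separated-injects : Injection (elements nonemptyNullSetoid separated) (elements nullSetoid G)
    separated-injects = record
      { to        = λ (q , t) → choose ⌊ Source q ⌋ t , proj₁ (source q t)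
      ; cong      = λ {(q , t)} {(r , u)} q≐r →
          Setoid.reflexive nullSetoid (choose-cong {p = t} {u} (⊑-antisym
            (λ N → fromWitness ∘ map₂ (Yields-cong q≐r) ∘ toWitness)
            (λ N → fromWitness ∘ map₂ (Yields-cong (≐-sym q≐r)) ∘ toWitness)))
      ; injective = λ {(q , t)} {(r , u)} N≐N′ →
          Yields-functional N≐N′ (proj₂ (source q t)) (proj₂ (source r u))
      }
      where
      source : ∀ q t → Source q (choose ⌊ Source q ⌋ t)
      source q t = toWitness (choose-∈ ⌊ Source q ⌋ t)

  ∃-separated : ∀ {G} → ¬ Null (⋃ G) →
    ∃[ F ] IncomparableFamily null∖∅ F
         × Injection (elements nonemptyNullSetoid F) (elements nullSetoid G)
  ∃-separated ¬null⋃ =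
    let M , M∈G , M≢∅ = ∃-nonempty-member ¬null⋃
        open Separate ¬null⋃ M∈G M≢∅
    in separated , separated-incomparable , separated-injects

  -- The two minimal sizes

  forget-bijection : ∀ F → Bijection (elements nonemptyNullSetoid F) (elements nullSetoid (forget F))
  forget-bijection F = record
    { to        = λ ((N , ne) , N∈F) → N , ne , N∈F
    ; cong      = id
    ; bijective = id , λ (N , ne , N∈F) → ((N , ne) , N∈F) , id
    }

  -- Starts from the family of all null sets: it contains every singleton, so its union is all of
  -- 2^ω.
  ∃-incomparable-family : ∃ (IncomparableFamily null∖∅)
  ∃-incomparable-family = let F , inc , _ = ∃-separated ¬null in F , inc
    where
    ¬null : ¬ Null (⋃ U)
    ¬null = ¬Null-full em λ x → (｛ x ｝ , Null-｛ x ｝) , tt , refl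

  𝔦𝔠𝔭≡add : ∃[ κ ] Is-𝔦𝔠𝔭 null∖∅ κ × Is-add-null κ
  𝔦𝔠𝔭≡add =
    let F , inc , is-𝔦𝔠𝔭 = ∃-minimal-size nonemptyNullSetoid ∃-incomparable-family
    in elements nonemptyNullSetoid F , is-𝔦𝔠𝔭
    , (forget F , incomparable⇒union-not-null inc , forget-bijection F)
    -- Minimality gives an injection into the incomparable family obtained from `G`, which in turn
    -- injects into `G`.
    , λ G ¬null⋃ → let H , inc-H , H↣G = ∃-separated ¬null⋃ in
        Composition.injection (proj₂ is-𝔦𝔠𝔭 H inc-H) H↣G

mainTheorem10 : (∀ {ℓ} → ExcludedMiddle ℓ) →
    (∀ {a b} → Extensionality a b) →
    ∃[ κ ] Is-𝔦𝔠𝔭 null∖∅ κ × Is-add-null κ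
mainTheorem10 em ext = 𝔦𝔠𝔭≡add em ext
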